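{- (1) Let $\mathfrak{F}$ be crisp. Then $\mathfrak{F}$ is finitely branching (i.e., $R(w)$ is finite for every $w\in\mathfrak{F}$) iff $\mathfrak{F}\models_{\mathbf{K}\mathsf{biG}}\mathbf{1}\ominus\lozenge((p\ominus q)\wedge q)$. (2) Let $\mathfrak{F}$ be fuzzy. Then $\mathfrak{F}$ is finitely branching and $\sup\{wRw':wRw'<1\}<1$ for all $w\in\mathfrak{F}$ iff $\mathfrak{F}\models_{\mathbf{K}\mathsf{biG}}\mathbf{1}\ominus\lozenge((p\ominus q)\wedge q)$.
   Context: $\ominus$ is Gödel coimplication: $b\ominus_\mathsf{G}a=0$ if $b\le a$, and $b$ otherwise; $a\rightarrow_\mathsf{G}b=1$ if $a\le b$, else $b$; $\wedge_\mathsf{G}=\min$, $\vee_\mathsf{G}=\max$; $\mathbf{1}:=p\rightarrow p$. A crisp frame is $\langle W,R\rangle$ with $R\subseteq W\times W$ and $R(w)=\{w':wRw'\}$; a fuzzy frame has $R:W\times W\to[0,1]$ and $R(w)=\{w':wRw'=1\}$. A $\mathbf{K}\mathsf{biG}$ model adds $v:\mathsf{Var}\times W\to[0,1]$, extended by the Gödel operations; on fuzzy frames $v(\lozenge\phi,w)=\sup_{w'}\{wRw'\wedge_\mathsf{G}v(\phi,w')\}$ and $v(\Box\phi,w)=\inf_{w'}\{wRw'\rightarrow_\mathsf{G}v(\phi,w')\}$; on crisp frames $v(\lozenge\phi,w)=\sup\{v(\phi,w'):wRw'\}$, $v(\Box\phi,w)=\inf\{v(\phi,w'):wRw'\}$ ($\sup\varnothing=0$,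 $\inf\varnothing=1$). $\mathfrak{F}\models_{\mathbf{K}\mathsf{biG}}\phi$ iff $v(\phi,w)=1$ for all $w$ and all models on $\mathfrak{F}$. -}

module Defs where

open import Axiom.ExcludedMiddle using (ExcludedMiddle)
open import Data.Bool.Base using (if_then_else_)
open import Data.List.Membership.Propositional using (_∈_)
open import Data.Nat.Base using (ℕ)
open import Data.Product.Base using (∃; ∃-syntax; _×_; _,_; proj₁; proj₂)
open import Data.Rational.Base as ℚ using (ℚ; 0ℚ; 1ℚ)
open import Data.Rational.Properties as ℚ using ()
open import Data.Sum.Base using (_⊎_; inj₁; inj₂; [_,_])
open import Function.Base using (id)
open import Function.Bundles using (_⇔_)
open import Level using (0ℓ)
open import Relation.Binary.Core using (Rel)
open import Relation.Nullary.Decidable.Core using (does)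
open import Relation.Unary using (Pred)
import Relation.Binary.Construct.NonStrictToStrict as NonStrictToStrict

------------------------------------------------------------------------
-- The real unit interval

-- A real x is represented by its Dedekind cut { q ∈ ℚ : q < x }.  The fields
-- `nonneg` and `bounded` say 0 ≤ x and x ≤ 1; they also make the cut inhabited
-- and proper.

record 𝕀 : Set₁ where
  field
    cut     : Pred ℚ 0ℓ
    down    : ∀ {p q} → p ℚ.< q → cut q → cut p
    rounded : ∀ {p} → cut p → ∃[ q ] p ℚ.< q × cut q
    nonneg  : ∀ {q} → q ℚ.< 0ℚ → cut q
    bounded : ∀ {q} → cut q → q ℚ.< 1ℚ

open 𝕀 public

infix 4 _≤_ _≈_ _<_

_≤_ : Rel 𝕀 0ℓ
x ≤ y = ∀ {q} → cut x q → cut y q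

-- Distinct predicates on ℚ may have the same elements, so equality of reals is
-- not _≡_.

_≈_ : Rel 𝕀 0ℓ
x ≈ y = x ≤ y × y ≤ x

_<_ : Rel 𝕀 0ℓ
_<_ = NonStrictToStrict._<_ _≈_ _≤_

0𝕀 : 𝕀
0𝕀 = record
  { cut     = ℚ._< 0ℚ
  ; down    = ℚ.<-trans
  ; rounded = ℚ.<-dense
  ; nonneg  = id
  ; bounded = λ q<0 → ℚ.<-trans q<0 (ℚ.positive⁻¹ 1ℚ)
  }

1𝕀 : 𝕀
1𝕀 = record
  { cut     = ℚ._< 1ℚ
  ; down    = ℚ.<-trans
  ; rounded = ℚ.<-dense
  ; nonneg  = λ q<0 → ℚ.<-trans q<0 (ℚ.positive⁻¹ 1ℚ)
  ; bounded = id
  }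

-- The supremum is the union of the cuts; the summand q < 0 makes sup ∅ = 0.

sup : {I : Set} → (I → 𝕀) → 𝕀
sup f = record
  { cut     = λ q → q ℚ.< 0ℚ ⊎ ∃[ i ] cut (f i) q
  ; down    = λ p<q → λ
      { (inj₁ q<0)     → inj₁ (ℚ.<-trans p<q q<0)
      ; (inj₂ (i , h)) → inj₂ (i , down (f i) p<q h)
      }
  ; rounded = λ
      { (inj₁ p<0)     → let r , p<r , r<0 = ℚ.<-dense p<0 in r , p<r , inj₁ r<0
      ; (inj₂ (i , h)) → let r , p<r , k = rounded (f i) h in r , p<r , inj₂ (i , k)
      }
  ; nonneg  = inj₁
  ; bounded = λ
      { (inj₁ q<0)     → bounded 0𝕀 q<0
      ; (inj₂ (i , h)) → bounded (f i) h
      }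
  }

-- The infimum is the rounded interior of the intersection of the cuts; the
-- conjunct r < 1 makes inf ∅ = 1.

inf : {I : Set} → (I → 𝕀) → 𝕀
inf f = record
  { cut     = λ q → ∃[ r ] q ℚ.< r × r ℚ.< 1ℚ × (∀ i → cut (f i) r)
  ; down    = λ { p<q (r , q<r , h) → r , ℚ.<-trans p<q q<r , h }
  ; rounded = λ { (r , p<r , h) →
      let s , p<s , s<r = ℚ.<-dense p<r in s , p<s , r , s<r , h }
  ; nonneg  = λ q<0 →
      let r , q<r , r<0 = ℚ.<-dense q<0
      in r , q<r , bounded 0𝕀 r<0 , λ i → nonneg (f i) r<0
  ; bounded = λ { (r , q<r , r<1 , _) → ℚ.<-trans q<r r<1 }
  }

module _ {I : Set} (f : I → 𝕀) where

  sup-upper : ∀ i → f i ≤ sup f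
  sup-upper i h = inj₂ (i , h)

  sup-least : ∀ x → (∀ i → f i ≤ x) → sup f ≤ x
  sup-least x f≤x = [ nonneg x , (λ { (i , h) → f≤x i h }) ]

  inf-lower : ∀ i → inf f ≤ f i
  inf-lower i (r , q<r , _ , h) = down (f i) q<r (h i)

  inf-greatest : ∀ x → (∀ i → x ≤ f i) → x ≤ inf f
  inf-greatest x x≤f h =
    let r , q<r , k = rounded x h in r , q<r , bounded x k , λ i → x≤f i k

------------------------------------------------------------------------
-- Formulas

Var : Set
Var = ℕ

infixr 7 _∧_
infixr 6 _∨_
infixr 5 _⊃_
infixl 5 _⊖_
infix  8 □_ ◇_

data Formula : Set where
  var             : Var → Formula
  _∧_ _∨_ _⊃_ _⊖_ : Formula → Formula → Formula
  □_ ◇_           : Formula → Formula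

𝟏 : Var → Formula
𝟏 p = var p ⊃ var p

------------------------------------------------------------------------
-- Frames

record CrispFrame : Set₁ where
  field
    W : Set
    R : Rel W 0ℓ

record FuzzyFrame : Set₁ where
  field
    W : Set
    R : W → W → 𝕀

-- Finiteness of the subset { x : P x }, irrespective of how many proofs P x has.

Finite : {A : Set} → Pred A 0ℓ → Set
Finite P = ∃[ xs ] (∀ x → P x ⇔ x ∈ xs)

module Crisp (𝔉 : CrispFrame) where
  open CrispFrame 𝔉

  FinitelyBranching : Set
  FinitelyBranching = ∀ w → Finite (R w)

module Fuzzy (𝔉 : FuzzyFrame) where
  open FuzzyFrame 𝔉

  FinitelyBranching : Set
  FinitelyBranching = ∀ w → Finite (λ w′ → R w w′ ≈ 1𝕀)

  supBelow1 : W → 𝕀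
  supBelow1 w = sup {I = ∃[ w′ ] R w w′ < 1𝕀} (λ i → R w (proj₁ i))

------------------------------------------------------------------------
-- Semantics

-- The Gödel operations are defined by cases on the order of two reals, which is
-- decidable only classically.

module KbiG (em : ExcludedMiddle 0ℓ) where

  infixr 7 _∧ᴳ_
  infixr 6 _∨ᴳ_
  infixr 5 _→ᴳ_
  infixl 5 _⊖ᴳ_

  _∧ᴳ_ _∨ᴳ_ _→ᴳ_ _⊖ᴳ_ : 𝕀 → 𝕀 → 𝕀
  a ∧ᴳ b = if does (em {a ≤ b}) then a  else b
  a ∨ᴳ b = if does (em {a ≤ b}) then b  else a
  a →ᴳ b = if does (em {a ≤ b}) then 1𝕀 else b
  b ⊖ᴳ a = if does (em {b ≤ a}) then 0𝕀 else b

  module Extension {W : Set} (box dia : (W → 𝕀) → W → 𝕀) (v : Var → W → 𝕀) where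

    ⟦_⟧ : Formula → W → 𝕀
    ⟦ var p ⟧ w = v p w
    ⟦ φ ∧ ψ ⟧ w = ⟦ φ ⟧ w ∧ᴳ ⟦ ψ ⟧ w
    ⟦ φ ∨ ψ ⟧ w = ⟦ φ ⟧ w ∨ᴳ ⟦ ψ ⟧ w
    ⟦ φ ⊃ ψ ⟧ w = ⟦ φ ⟧ w →ᴳ ⟦ ψ ⟧ w
    ⟦ φ ⊖ ψ ⟧ w = ⟦ φ ⟧ w ⊖ᴳ ⟦ ψ ⟧ w
    ⟦ □ φ   ⟧ w = box ⟦ φ ⟧ w
    ⟦ ◇ φ   ⟧ w = dia ⟦ φ ⟧ w

  module _ (𝔉 : CrispFrame) where
    open CrispFrame 𝔉

    □ᶜ ◇ᶜ : (W → 𝕀) → W → 𝕀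
    □ᶜ f w = inf {I = ∃ (R w)} (λ i → f (proj₁ i))
    ◇ᶜ f w = sup {I = ∃ (R w)} (λ i → f (proj₁ i))

  module _ (𝔉 : FuzzyFrame) where
    open FuzzyFrame 𝔉

    □ᶠ ◇ᶠ : (W → 𝕀) → W → 𝕀
    □ᶠ f w = inf (λ w′ → R w w′ →ᴳ f w′)
    ◇ᶠ f w = sup (λ w′ → R w w′ ∧ᴳ f w′)

  infix 4 _⊨ᶜ_ _⊨ᶠ_

  _⊨ᶜ_ : CrispFrame → Formula → Set₁
  𝔉 ⊨ᶜ φ = ∀ v w → Extension.⟦_⟧ (□ᶜ 𝔉) (◇ᶜ 𝔉) v φ w ≈ 1𝕀

  _⊨ᶠ_ : FuzzyFrame → Formula → Set₁
  𝔉 ⊨ᶠ φ = ∀ v w → Extension.⟦_⟧ (□ᶠ 𝔉) (◇ᶠ 𝔉) v φ w ≈ 1𝕀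

{-# OPTIONS --safe #-}

-- Call f : W → 𝕀 subunital if it never takes the value 1.  The functions of the
-- form (p ⊖ q) ∧ q are subunital, and every subunital g arises in this way from
-- p = 1 and q = g.  Hence 𝟏 ⊖ ◇ ((p ⊖ q) ∧ q) is valid on a frame iff ◇ maps
-- subunital functions to subunital functions.  Finitely many values below 1 have
-- a maximum below 1, whereas along infinitely many successors w₀, w₁, … the values
-- g wₙ = n / (n + 1) have supremum 1.  On a fuzzy frame the successors with degree
-- below 1 contribute at most supBelow1, and g = R w (set to 0 where R w is 1)
-- attains that bound.

module Submission where

open import Defs
open import Axiom.ExcludedMiddle using (ExcludedMiddle)
open import Data.Bool.Base using (if_then_else_)
open import Data.Empty using (⊥-elim)
open import Data.Integer.Base as ℤ using (+_; -[1+_])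
import Data.Integer.Properties as ℤ
open import Data.List.Base using (List; []; _∷_)
open import Data.List.Membership.Propositional using (_∈_; _∉_)
open import Data.List.Relation.Unary.All as All using (All; []; _∷_)
open import Data.List.Relation.Unary.Any using (here; there)
open import Data.Nat.Base as ℕ using (ℕ; zero; suc)
import Data.Nat.Coprimality as Coprimality
import Data.Nat.Properties as ℕ
open import Data.Product.Base using (∃; ∃-syntax; _×_; _,_; proj₁; proj₂)
open import Data.Rational.Base as ℚ using (ℚ; mkℚ; 0ℚ; 1ℚ; *<*)
import Data.Rational.Properties as ℚ
open import Data.Sum.Base using (inj₂)
open import Function.Base using (_∘_; const; case_of_)
open import Function.Bundles using (_⇔_; mk⇔; Equivalence)
open import Function.Construct.Composition using (_⇔-∘_)
open import Function.Construct.Symmetry using (⇔-sym)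
open import Function.Definitions using (Injective)
open import Level using (0ℓ)
open import Relation.Binary.Definitions using (tri<; tri≈; tri>)
open import Relation.Binary.PropositionalEquality.Core using (_≡_; _≢_; refl; sym; subst; subst₂; cong)
open import Relation.Nullary using (¬_; yes; no; does)
open import Relation.Nullary.Decidable using (dec-true; dec-false; decidable-stable)
open import Relation.Unary using (Pred)

≈-refl : ∀ x → x ≈ x
≈-refl x = (λ h → h) , λ h → h

x≤1 : ∀ x → x ≤ 1𝕀
x≤1 x = bounded x

1≰⇒<1 : ∀ x → ¬ 1𝕀 ≤ x → x < 1𝕀
1≰⇒<1 x 1≰x = x≤1 x , λ (_ , 1≤x) → 1≰x 1≤x

<1⇒1≰ : ∀ x → x < 1𝕀 → ¬ 1𝕀 ≤ x
<1⇒1≰ x (x≤1 , x≉1) 1≤x = x≉1 (x≤1 , 1≤x)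

1≰0 : ¬ 1𝕀 ≤ 0𝕀
1≰0 1≤0 = ℚ.<-irrefl refl (1≤0 {0ℚ} (ℚ.positive⁻¹ 1ℚ))

-- Rationals n / (n + 1) approaching 1.

ratio : ℕ → ℚ
ratio n = mkℚ (+ n) n (Coprimality.sym (subst (λ m → Coprimality.Coprime m n)
  (ℕ.+-comm n 1) (Coprimality.coprime-+ (Coprimality.1-coprimeTo n))))

ratio<1 : ∀ n → ratio n ℚ.< 1ℚ
ratio<1 n = *<* (subst₂ ℤ._<_ (sym (ℤ.*-identityʳ (+ n))) (sym (ℤ.*-identityˡ (+ suc n)))
  (ℤ.+<+ (ℕ.n<1+n n)))

-- This is a / (d + 1) < (d + 1) / (d + 2) after cross-multiplication; it rests on d (d + 2) + 1 =
-- (d + 1)².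
a≤d⇒a*[2+d]<[1+d]² : ∀ {a d} → a ℕ.≤ d → a ℕ.* (2 ℕ.+ d) ℕ.< suc d ℕ.* suc d
a≤d⇒a*[2+d]<[1+d]² {a} {d} a≤d = begin-strict
  a ℕ.* (2 ℕ.+ d)       ≤⟨ ℕ.*-monoˡ-≤ (2 ℕ.+ d) a≤d ⟩
  d ℕ.* (2 ℕ.+ d)       <⟨ ℕ.n<1+n _ ⟩
  suc (d ℕ.* (2 ℕ.+ d)) ≡⟨ cong suc (ℕ.*-suc d (suc d)) ⟩
  suc d ℕ.* suc d       ∎
  where open ℕ.≤-Reasoning

-- A nonnegative r = a / (d + 1) below 1 has a ≤ d, so r is at most `ratio d` and strictly below
-- `ratio (suc d)`. A negative r is below any `ratio n`.
ratio-cofinal : ∀ {r} → r ℚ.< 1ℚ → ∃[ n ] r ℚ.< ratio n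
ratio-cofinal {mkℚ (+ a) d _} (*<* a*1<1*[1+d]) = suc d , *<*
  (subst₂ ℤ._<_ (ℤ.pos-* a (2 ℕ.+ d)) (ℤ.pos-* (suc d) (suc d))
    (ℤ.+<+ (a≤d⇒a*[2+d]<[1+d]² (ℕ.s≤s⁻¹ (ℤ.drop‿+<+ a<1+d)))))
  where
  a<1+d : + a ℤ.< + suc d
  a<1+d = subst₂ ℤ._<_ (ℤ.*-identityʳ (+ a)) (ℤ.*-identityˡ (+ suc d)) a*1<1*[1+d]
ratio-cofinal {mkℚ -[1+ _ ] d _} _ = suc d , *<* ℤ.-<+

ratio𝕀 : ℕ → 𝕀
ratio𝕀 n = record
  { cut     = ℚ._< ratio n
  ; down    = ℚ.<-trans
  ; rounded = ℚ.<-dense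
  ; nonneg  = λ q<0 → ℚ.<-≤-trans q<0 (ℚ.nonNegative⁻¹ (ratio n))
  ; bounded = λ q<r → ℚ.<-trans q<r (ratio<1 n)
  }

1≰ratio𝕀 : ∀ n → ¬ 1𝕀 ≤ ratio𝕀 n
1≰ratio𝕀 n 1≤r = ℚ.<-irrefl refl (1≤r (ratio<1 n))

Subunital : {A : Set} → (A → 𝕀) → Set
Subunital f = ∀ x → ¬ 1𝕀 ≤ f x

module Classical (em : ExcludedMiddle 0ℓ) where
  open KbiG em

  -- Order properties of the Gödel operations.

  ≰⇒≥ : ∀ x y → ¬ x ≤ y → y ≤ x
  ≰⇒≥ x y x≰y {q} q∈y = decidable-stable em λ q∉x →
    -- If `q` lies in `y` but not in `x`, no `r` in `x` exceeds `q`, so `x ≤ y` after all.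
    x≰y λ {r} r∈x → case ℚ.<-cmp r q of λ
      { (tri< r<q _ _)  → down y r<q q∈y
      ; (tri≈ _ refl _) → q∈y
      ; (tri> _ _ q<r)  → ⊥-elim (q∉x (down x q<r r∈x))
      }

  ∧-lowerˡ : ∀ x y → x ∧ᴳ y ≤ x
  ∧-lowerˡ x y with em {x ≤ y}
  ... | yes _   = λ h → h
  ... | no  x≰y = ≰⇒≥ x y x≰y

  ∧-lowerʳ : ∀ x y → x ∧ᴳ y ≤ y
  ∧-lowerʳ x y with em {x ≤ y}
  ... | yes x≤y = x≤y
  ... | no  _   = λ h → h

  ∧-greatest : ∀ x y z → z ≤ x → z ≤ y → z ≤ x ∧ᴳ y
  ∧-greatest x y z z≤x z≤y with em {x ≤ y}
  ... | yes _ = z≤x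
  ... | no  _ = z≤y

  ∨-upperˡ : ∀ x y → x ≤ x ∨ᴳ y
  ∨-upperˡ x y with em {x ≤ y}
  ... | yes x≤y = x≤y
  ... | no  _   = λ h → h

  ∨-upperʳ : ∀ x y → y ≤ x ∨ᴳ y
  ∨-upperʳ x y with em {x ≤ y}
  ... | yes _   = λ h → h
  ... | no  x≰y = ≰⇒≥ x y x≰y

  1≰∨ : ∀ x y → ¬ 1𝕀 ≤ x → ¬ 1𝕀 ≤ y → ¬ 1𝕀 ≤ x ∨ᴳ y
  1≰∨ x y 1≰x 1≰y with em {x ≤ y}
  ... | yes _ = 1≰y
  ... | no  _ = 1≰x

  -- If `x ≤ y`, the first conjunct is 0. Otherwise a value of 1 would force `y` to be 1, and then
  -- `x ≤ y`.
  [x⊖y]∧y≱1 : ∀ x y → ¬ 1𝕀 ≤ (x ⊖ᴳ y) ∧ᴳ y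
  [x⊖y]∧y≱1 x y 1≤ with em {x ≤ y}
  ... | yes _   = 1≰0 (λ h → ∧-lowerˡ 0𝕀 y (1≤ h))
  ... | no  x≰y = x≰y (λ h → ∧-lowerʳ x y (1≤ (x≤1 x h)))

  y≤[1⊖y]∧y : ∀ y → ¬ 1𝕀 ≤ y → y ≤ (1𝕀 ⊖ᴳ y) ∧ᴳ y
  y≤[1⊖y]∧y y 1≰y with em {1𝕀 ≤ y}
  ... | yes 1≤y = ⊥-elim (1≰y 1≤y)
  ... | no  _   = ∧-greatest 1𝕀 y y (x≤1 y) (λ h → h)

  [x→x]⊖y≈1⇔1≰y : ∀ x y → ((x →ᴳ x) ⊖ᴳ y ≈ 1𝕀) ⇔ (¬ 1𝕀 ≤ y)
  -- `em` does not compute, so even this reflexive instance must be split on before `x →ᴳ x` reduces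
  -- to `1𝕀`.
  [x→x]⊖y≈1⇔1≰y x y with em {x ≤ x}
  ... | no x≰x = ⊥-elim (x≰x (λ h → h))
  ... | yes _ with em {1𝕀 ≤ y}
  ...   | yes 1≤y = mk⇔ (λ (_ , 1≤0) _ → 1≰0 1≤0) (λ 1≰y → ⊥-elim (1≰y 1≤y))
  ...   | no  1≰y = mk⇔ (const 1≰y) (const (≈-refl 1𝕀))

  -- Validity as preservation of subunital functions.

  PreservesSubunital : {W : Set} → ((W → 𝕀) → W → 𝕀) → Set₁
  PreservesSubunital dia = ∀ g → Subunital g → Subunital (dia g)

  Monotone : {W : Set} → ((W → 𝕀) → W → 𝕀) → Set₁
  Monotone dia = ∀ f g → (∀ x → f x ≤ g x) → ∀ w → dia f w ≤ dia g w

  module _ {W : Set} (box dia : (W → 𝕀) → W → 𝕀) (dia-mono : Monotone dia)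
           (p q : Var) (p≢q : p ≢ q) where

    open Extension box dia using (⟦_⟧)

    private
      ψ : Formula
      ψ = (var p ⊖ var q) ∧ var q

      valuation : (W → 𝕀) → Var → W → 𝕀
      valuation g r = if does (r ℕ.≟ q) then g else const 1𝕀

      g≤⟦ψ⟧ : ∀ g → Subunital g → ∀ x → g x ≤ ⟦_⟧ (valuation g) ψ x
      g≤⟦ψ⟧ g g<1 x
        -- These evaluate the valuation at `q` to `g` and, thanks to `p≢q`, at `p` to the constant
        -- 1.
        rewrite dec-true (q ℕ.≟ q) refl | dec-false (p ℕ.≟ q) p≢q
        = y≤[1⊖y]∧y (g x) (g<1 x)

    -- Being abstract in `dia`, this serves crisp and fuzzy frames alike.
    valid⇔preservesSubunital :
      (∀ v w → ⟦_⟧ v (𝟏 p ⊖ ◇ ψ) w ≈ 1𝕀) ⇔ PreservesSubunital dia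
    valid⇔preservesSubunital = mk⇔ to from
      where
      to : (∀ v w → ⟦_⟧ v (𝟏 p ⊖ ◇ ψ) w ≈ 1𝕀) → PreservesSubunital dia
      to valid g g<1 w 1≤◇g =
        Equivalence.to ([x→x]⊖y≈1⇔1≰y (valuation g p w) (⟦_⟧ (valuation g) (◇ ψ) w))
          (valid (valuation g) w)
          -- Since `g` lies below `ψ` pointwise, monotonicity carries a value 1 of `◇ g` over to
          -- `◇ ψ`.
          λ h → dia-mono g _ (g≤⟦ψ⟧ g g<1) w (1≤◇g h)

      from : PreservesSubunital dia → ∀ v w → ⟦_⟧ v (𝟏 p ⊖ ◇ ψ) w ≈ 1𝕀
      from pres v w = Equivalence.from ([x→x]⊖y≈1⇔1≰y (v p w) (⟦_⟧ v (◇ ψ) w))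
        (pres (⟦_⟧ v ψ) (λ x → [x⊖y]∧y≱1 (v p x) (v q x)) w)

  -- Bounds over finite lists.

  bound-on-list : {A : Set} (f : A → 𝕀) → Subunital f → (xs : List A) →
    ∃[ b ] (¬ 1𝕀 ≤ b) × (∀ {x} → x ∈ xs → f x ≤ b)
  bound-on-list f f<1 []       = 0𝕀 , 1≰0 , λ ()
  bound-on-list f f<1 (x ∷ xs) =
    let b , 1≰b , f≤b = bound-on-list f f<1 xs
    -- A binary maximum is one of its two arguments, so it stays below 1.
    in  f x ∨ᴳ b , 1≰∨ (f x) b (f<1 x) 1≰b , λ
          { (here refl) → ∨-upperˡ (f x) b
          ; (there x∈)  → λ h → ∨-upperʳ (f x) b (f≤b x∈ h)
          }

  -- An injective sequence in an infinite set.

  module InfinitePred {A : Set} (P : Pred A 0ℓ) (infinite : ¬ Finite P) where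

    -- Without a fresh element, `xs` itself would enumerate `P`. As `em` returns the witness, the
    -- choice is a function of the list and its proof.
    fresh : ∀ xs → All P xs → ∃[ x ] P x × x ∉ xs
    fresh xs Pxs = decidable-stable em λ ¬fresh → infinite
      (xs , λ x → mk⇔ (λ Px → decidable-stable em λ x∉xs → ¬fresh (x , Px , x∉xs))
                      (All.lookup Pxs))

    prefix : ℕ → ∃ (All P)
    prefix zero    = [] , []
    prefix (suc n) = let xs , Pxs = prefix n
                         x , Px , _ = fresh xs Pxs
                     in x ∷ xs , Px ∷ Pxs

    sequence : ℕ → A
    sequence n = proj₁ (fresh _ (proj₂ (prefix n)))

    sequence-P : ∀ n → P (sequence n)
    sequence-P n = proj₁ (proj₂ (fresh _ (proj₂ (prefix n))))

    -- `<′` is built by raising the upper bound, which matches how `prefix` grows by one head at a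
    -- time.
    sequence∈prefix : ∀ {m n} → m ℕ.<′ n → sequence m ∈ proj₁ (prefix n)
    sequence∈prefix ℕ.<′-base       = here refl
    sequence∈prefix (ℕ.≤′-step m<n) = there (sequence∈prefix m<n)

    <⇒sequence≢ : ∀ {m n} → m ℕ.< n → sequence m ≢ sequence n
    <⇒sequence≢ {m} {n} m<n eq = proj₂ (proj₂ (fresh _ (proj₂ (prefix n))))
      (subst (_∈ proj₁ (prefix n)) eq (sequence∈prefix (ℕ.<⇒<′ m<n)))

    sequence-injective : Injective _≡_ _≡_ sequence
    sequence-injective {m} {n} eq with ℕ.<-cmp m n
    ... | tri< m<n _ _ = ⊥-elim (<⇒sequence≢ m<n eq)
    ... | tri≈ _ m≡n _ = m≡n
    ... | tri> _ _ n<m = ⊥-elim (<⇒sequence≢ n<m (sym eq))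

    -- By injectivity the supremum has at most one term, so no choice of an
    -- inverse of the sequence is needed.
    ratioAlong : A → 𝕀
    ratioAlong x = sup {I = ∃[ n ] sequence n ≡ x} (ratio𝕀 ∘ proj₁)

    ratioAlong-subunital : Subunital ratioAlong
    ratioAlong-subunital x 1≤ with em {∃[ n ] sequence n ≡ x}
    ... | yes (n , refl) = 1≰ratio𝕀 n λ h → sup-least (ratio𝕀 ∘ proj₁) (ratio𝕀 n)
            (λ (m , eq) → subst (λ k → ratio𝕀 m ≤ ratio𝕀 k) (sequence-injective eq) (λ h → h))
            (1≤ h)
    -- Off the sequence the supremum is empty, hence 0.
    ... | no  ∄n         = 1≰0 λ h → sup-least (ratio𝕀 ∘ proj₁) 0𝕀 (λ i → ⊥-elim (∄n i)) (1≤ h)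

    1≤sup-ratioAlong : 1𝕀 ≤ sup {I = ∃ P} (ratioAlong ∘ proj₁)
    1≤sup-ratioAlong q<1 =
      let n , q<ratio = ratio-cofinal q<1
      in  inj₂ ((sequence n , sequence-P n) , inj₂ ((n , refl) , q<ratio))

  -- Crisp frames.

  module _ (𝔉 : CrispFrame) where
    open CrispFrame 𝔉
    open Crisp 𝔉

    ◇ᶜ-monotone : Monotone (◇ᶜ 𝔉)
    ◇ᶜ-monotone f g f≤g w =
      sup-least (f ∘ proj₁) (◇ᶜ 𝔉 g w) λ i h → sup-upper (g ∘ proj₁) i (f≤g (proj₁ i) h)

    finitelyBranching⇔◇ᶜ-preserves : FinitelyBranching ⇔ PreservesSubunital (◇ᶜ 𝔉)
    finitelyBranching⇔◇ᶜ-preserves = mk⇔ to from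
      where
      to : FinitelyBranching → PreservesSubunital (◇ᶜ 𝔉)
      to fb g g<1 w 1≤◇g =
        let xs , R⇔∈ = fb w
            b , 1≰b , g≤b = bound-on-list g g<1 xs
        in  1≰b λ h → sup-least (g ∘ proj₁) b
              (λ (x , wRx) → g≤b (Equivalence.to (R⇔∈ x) wRx)) (1≤◇g h)

      from : PreservesSubunital (◇ᶜ 𝔉) → FinitelyBranching
      from pres w = decidable-stable em λ infinite →
        let open InfinitePred (R w) infinite
        -- `◇ᶜ 𝔉 ratioAlong w` unfolds to the very supremum that reaches 1.
        in  pres ratioAlong ratioAlong-subunital w 1≤sup-ratioAlong

  -- Fuzzy frames.

  module _ (𝔉 : FuzzyFrame) where
    open FuzzyFrame 𝔉
    open Fuzzy 𝔉

    ◇ᶠ-monotone : Monotone (◇ᶠ 𝔉)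
    ◇ᶠ-monotone f g f≤g w = sup-least (λ x → R w x ∧ᴳ f x) (◇ᶠ 𝔉 g w) λ x h →
      sup-upper (λ x → R w x ∧ᴳ g x) x (∧-greatest (R w x) (g x) (R w x ∧ᴳ f x)
        (∧-lowerˡ (R w x) (f x)) (λ k → f≤g x (∧-lowerʳ (R w x) (f x) k)) h)

    -- Below both `R w x` and `g x` means below their minimum, a term of `◇ᶠ`. Both halves of the
    -- converse bound `◇ᶠ` from below this way.
    sup≤◇ᶠ : ∀ {P : Pred W 0ℓ} (f : W → 𝕀) g w → (∀ x → P x → f x ≤ R w x × f x ≤ g x) →
      sup {I = ∃ P} (f ∘ proj₁) ≤ ◇ᶠ 𝔉 g w
    sup≤◇ᶠ f g w f≤ = sup-least (f ∘ proj₁) (◇ᶠ 𝔉 g w) λ (x , Px) h →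
      sup-upper (λ x → R w x ∧ᴳ g x) x
        (∧-greatest (R w x) (g x) (f x) (proj₁ (f≤ x Px)) (proj₂ (f≤ x Px)) h)

    degreeBelow1 : W → W → 𝕀
    degreeBelow1 w x = if does (em {1𝕀 ≤ R w x}) then 0𝕀 else R w x

    degreeBelow1-subunital : ∀ w → Subunital (degreeBelow1 w)
    degreeBelow1-subunital w x with em {1𝕀 ≤ R w x}
    ... | yes _   = 1≰0
    ... | no  1≰R = 1≰R

    degree≤degreeBelow1 : ∀ w x → R w x < 1𝕀 → R w x ≤ degreeBelow1 w x
    degree≤degreeBelow1 w x R<1 with em {1𝕀 ≤ R w x}
    ... | yes 1≤R = ⊥-elim (<1⇒1≰ (R w x) R<1 1≤R)
    ... | no  _   = λ h → h

    finitelyBranching×supBelow1⇔◇ᶠ-preserves :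
      (FinitelyBranching × (∀ w → supBelow1 w < 1𝕀)) ⇔ PreservesSubunital (◇ᶠ 𝔉)
    finitelyBranching×supBelow1⇔◇ᶠ-preserves = mk⇔ to (λ pres → finite pres , below pres)
      where
      to : FinitelyBranching × (∀ w → supBelow1 w < 1𝕀) → PreservesSubunital (◇ᶠ 𝔉)
      to (fb , s<1) g g<1 w 1≤◇g =
        1≰∨ b s 1≰b (<1⇒1≰ s (s<1 w))
          λ h → sup-least (λ x → R w x ∧ᴳ g x) (b ∨ᴳ s) term≤b∨s (1≤◇g h)
        where
        s = supBelow1 w
        bound = bound-on-list g g<1 (proj₁ (fb w))
        b = proj₁ bound
        1≰b = proj₁ (proj₂ bound)

        term≤b∨s : ∀ x → R w x ∧ᴳ g x ≤ b ∨ᴳ s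
        -- At degree 1 the world is on the list and `g x` is at most `b`; otherwise the degree
        -- itself is at most `s`.
        term≤b∨s x h with em {1𝕀 ≤ R w x}
        ... | yes 1≤R = ∨-upperˡ b s (proj₂ (proj₂ bound)
                (Equivalence.to (proj₂ (fb w) x) (x≤1 (R w x) , 1≤R))
                (∧-lowerʳ (R w x) (g x) h))
        ... | no  1≰R = ∨-upperʳ b s (sup-upper (R w ∘ proj₁)
                (x , 1≰⇒<1 (R w x) 1≰R)
                (∧-lowerˡ (R w x) (g x) h))

      finite : PreservesSubunital (◇ᶠ 𝔉) → FinitelyBranching
      finite pres w = decidable-stable em λ infinite →
        let open InfinitePred (λ x → R w x ≈ 1𝕀) infinite
        in  pres ratioAlong ratioAlong-subunital w λ h →
              sup≤◇ᶠ ratioAlong ratioAlong w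
                -- At degree 1 the edge imposes no cap, so `ratioAlong` is below both factors.
                (λ x (_ , 1≤R) → (λ k → 1≤R (x≤1 (ratioAlong x) k)) , λ k → k)
                (1≤sup-ratioAlong h)

      below : PreservesSubunital (◇ᶠ 𝔉) → ∀ w → supBelow1 w < 1𝕀
      below pres w = 1≰⇒<1 (supBelow1 w) λ 1≤s →
        pres (degreeBelow1 w) (degreeBelow1-subunital w) w λ h →
          sup≤◇ᶠ (R w) (degreeBelow1 w) w
            (λ x R<1 → (λ k → k) , degree≤degreeBelow1 w x R<1) (1≤s h)

theorem2 : (em : ExcludedMiddle 0ℓ) →
    let open KbiG em in
    (p q : Var) → p ≢ q →
    ((𝔉 : CrispFrame) →
    Crisp.FinitelyBranching 𝔉
    ⇔ 𝔉 ⊨ᶜ 𝟏 p ⊖ ◇ ((var p ⊖ var q) ∧ var q))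
    ×
    ((𝔉 : FuzzyFrame) →
    (Fuzzy.FinitelyBranching 𝔉 × (∀ w → Fuzzy.supBelow1 𝔉 w < 1𝕀))
    ⇔ 𝔉 ⊨ᶠ 𝟏 p ⊖ ◇ ((var p ⊖ var q) ∧ var q))
theorem2 em p q p≢q =
  (λ 𝔉 → ⇔-sym (valid⇔preservesSubunital (□ᶜ 𝔉) (◇ᶜ 𝔉) (◇ᶜ-monotone 𝔉) p q p≢q)
    ⇔-∘ finitelyBranching⇔◇ᶜ-preserves 𝔉) ,
  (λ 𝔉 → ⇔-sym (valid⇔preservesSubunital (□ᶠ 𝔉) (◇ᶠ 𝔉) (◇ᶠ-monotone 𝔉) p q p≢q)
    ⇔-∘ finitelyBranching×supBelow1⇔◇ᶠ-preserves 𝔉)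
  where
  open KbiG em
  open Classical em
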